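{- Let $\tau$ be a functional signature and let $\mathcal{C}$ be a pseudovariety of finitely generated $\tau$-algebras. Then there exists a uniformity $\mathcal{U}^{\mathcal{C}}=(\mathcal{U}^{\mathcal{C}}_k)_{k\ge 1}$ on the clone $\mathscr{F}^{\mathcal{C}}$ of the free algebra for $\mathcal{C}$ (that is, for each $k\geq 1$ a uniformity $\mathcal{U}^{\mathcal{C}}_k$ on the set $F^{\mathcal{C}}_k$ of its $k$-ary elements) such that for every finitely generated $\tau$-algebra $\mathfrak{A}$ the following are equivalent: (i) $\mathfrak{A}\in\mathcal{C}$; (ii) the natural clone homomorphism from $\mathscr{F}^{\mathcal{C}}$ onto $\operatorname{Clo}(\mathfrak{A})$ is well-defined and uniformly continuous with respect to $\mathcal{U}^{\mathcal{C}}$ and the uniformity of pointwise convergence on $\operatorname{Clo}(\mathfrak{A})$.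
   Context: Algebras are nonempty; $A$ denotes the domain of $\mathfrak{A}$. For $k\ge1$, $T_k$ is the set of abstract $\tau$-terms over the variables $x_1,\dots,x_k$, and for $t\in T_k$, $t^{\mathfrak{A}}\colon A^k\to A$ is the induced $k$-ary term operation. $\operatorname{Clo}(\mathfrak{A})=\{t^{\mathfrak{A}}\mid t\in T_k,\ k\ge 1\}$ is the term clone of $\mathfrak{A}$; its $k$-ary part is $\operatorname{Clo}(\mathfrak{A})_k=\{t^{\mathfrak{A}}\mid t\in T_k\}$. A class $\mathcal{C}$ of finitely generated $\tau$-algebras is a pseudovariety of finitely generated algebras if it is closed under homomorphic images (in particular isomorphic copies) and contains every algebra isomorphic to a finitely generated subalgebra of a finite product of members of $\mathcal{C}$. Finite products include the empty product (the one-element algebra). For a class $\mathcal{C}$ of $\tau$-algebras, let $\Sigma(\mathcal{C})$ be the set of identities between $\tau$-terms over a countable set of variables holding in all members of $\mathcal{C}$. The free algebra for $\mathcal{C}$ is the algebra of all $\tau$-terms over countably many variables modulo $\Sigma(\mathcal{C})$, and $\mathscr{F}^{\mathcal{C}}$ is its term clone. The $k$-ary part of $\mathscr{F}^{\mathcal{C}}$ is identified with $F^{\mathcal{C}}_k$, the set of classes $[t]$ of terms $t\in T_k$ modulo $\Sigma(\mathcal{C})$. The natural clone homomorphism $\mathscr{F}^{\mathcal{C}}\to\operatorname{Clo}(\mathfrak{A})$ is the assignment $[t]\mapsto t^{\mathfrak{A}}$ ($t\in T_k$, $k\ge1$); it is well-defined if $[s]=[t]$ implies $s^{\mathfrak{A}}=t^{\mathfrak{A}}$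 for all $k\ge 1$ and $s,t\in T_k$. A uniformity on a set $X$ is a (nonempty) filter $\mathcal{U}$ of subsets of $X\times X$, all containing the diagonal, closed under converse $U\mapsto U^{ -1}$, and such that for each $U\in\mathcal{U}$ there is $V\in\mathcal{U}$ with $V\circ V\subseteq U$. A uniformity on a clone means a family of uniformities, one on the set of $k$-ary elements for each $k\ge1$; a map between clones that preserves arities is uniformly continuous if for every $k\ge1$ its restriction to $k$-ary elements is uniformly continuous (preimages of entourages are entourages). The uniformity of pointwise convergence on $\operatorname{Clo}(\mathfrak{A})$ is, for each $k\ge1$, the filter on $\operatorname{Clo}(\mathfrak{A})_k\times\operatorname{Clo}(\mathfrak{A})_k$ generated by the sets $\{(f,g)\mid f(\overline{a})=g(\overline{a})\}$, $\overline{a}\in A^k$. -}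

module Defs where

open import Data.Fin using (Fin; toℕ; _↑ˡ_; _↑ʳ_)
open import Data.Nat using (ℕ; NonZero; _+_)
open import Data.Product using (Σ; ∃; _×_; _,_; proj₁; proj₂)
open import Data.Vec.Functional using (Vector; []; _++_)
open import Data.Vec.Functional.Properties using (lookup-++ˡ; lookup-++ʳ)
open import Function using (flip; _∘_)
open import Function.Bundles using (Func)
open import Function.Definitions using (Surjective; Bijective)
open import Level using (Level; _⊔_; Lift; lift; lower) renaming (suc to lsuc)
open import Relation.Binary using (Setoid; Rel; _⇒_; _Respects_; _Respects₂_; Reflexive; Trans; IsEquivalence)
open import Relation.Binary.Construct.Intersection using (_∩_)
open import Relation.Binary.PropositionalEquality using (subst)

------------------------------------------------------------------------
-- Universal algebra.  Sets are setoids; everything about algebras lives in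
-- one universe level ℓ.

record Signature (ℓ : Level) : Set (lsuc ℓ) where
  field
    Symbol : Set ℓ
    arity  : Symbol → ℕ

open Signature

data Term {ℓ} (τ : Signature ℓ) (V : Set) : Set ℓ where
  var : V → Term τ V
  app : (f : Symbol τ) → Vector (Term τ V) (arity τ f) → Term τ V

rename : ∀ {ℓ} {τ : Signature ℓ} {V W : Set} → (V → W) → Term τ V → Term τ W
rename ρ (var x)    = var (ρ x)
rename ρ (app f ts) = app f (λ i → rename ρ (ts i))

record Algebra {ℓ} (τ : Signature ℓ) : Set (lsuc ℓ) where
  field
    setoid : Setoid ℓ ℓ
  open Setoid setoid public
  field
    nonempty : Carrier
    op       : (f : Symbol τ) → Vector Carrier (arity τ f) → Carrier
    op-cong  : (f : Symbol τ) {xs ys : Vector Carrier (arity τ f)} →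
               (∀ i → xs i ≈ ys i) → op f xs ≈ op f ys

module _ {ℓ : Level} {τ : Signature ℓ} where

  eval : (𝔄 : Algebra τ) {V : Set} → (V → Algebra.Carrier 𝔄) → Term τ V → Algebra.Carrier 𝔄
  eval 𝔄 ρ (var x)    = ρ x
  eval 𝔄 ρ (app f ts) = Algebra.op 𝔄 f (λ i → eval 𝔄 ρ (ts i))

  record Homomorphism (𝔄 𝔅 : Algebra τ) : Set ℓ where
    private
      module A = Algebra 𝔄
      module B = Algebra 𝔅
    field
      func : Func A.setoid B.setoid
    open Func func public using (to) renaming (cong to to-cong)
    field
      homo : ∀ f (xs : Vector A.Carrier (arity τ f)) → to (A.op f xs) B.≈ B.op f (to ∘ xs)

  HomomorphicImage : (𝔅 𝔄 : Algebra τ) → Set ℓ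
  HomomorphicImage 𝔅 𝔄 = Σ (Homomorphism 𝔄 𝔅) λ h →
    Surjective (Algebra._≈_ 𝔄) (Algebra._≈_ 𝔅) (Homomorphism.to h)

  Isomorphic : (𝔄 𝔅 : Algebra τ) → Set ℓ
  Isomorphic 𝔄 𝔅 = Σ (Homomorphism 𝔄 𝔅) λ h →
    Bijective (Algebra._≈_ 𝔄) (Algebra._≈_ 𝔅) (Homomorphism.to h)

  -- Possibly empty; nonemptiness is demanded only when passing to the subalgebra.
  record Subuniverse (𝔄 : Algebra τ) : Set (lsuc ℓ) where
    open Algebra 𝔄
    field
      Member    : Carrier → Set ℓ
      respects  : Member Respects _≈_
      op-closed : ∀ f (xs : Vector Carrier (arity τ f)) → (∀ i → Member (xs i)) → Member (op f xs)

  subalgebra : (𝔄 : Algebra τ) (S : Subuniverse 𝔄) → ∃ (Subuniverse.Member S) → Algebra τ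
  subalgebra 𝔄 S inhabited = record
    { setoid   = record
      { Carrier       = ∃ Member
      ; _≈_           = λ x y → proj₁ x ≈ proj₁ y
      ; isEquivalence = record { refl = refl ; sym = sym ; trans = trans }
      }
    ; nonempty = inhabited
    ; op       = λ f xs → op f (proj₁ ∘ xs) , op-closed f (proj₁ ∘ xs) (proj₂ ∘ xs)
    ; op-cong  = λ f p → op-cong f p
    }
    where
    open Algebra 𝔄
    open Subuniverse S

  ∏ : ∀ {n} → (Fin n → Algebra τ) → Algebra τ
  ∏ 𝔅 = record
    { setoid   = record
      { Carrier       = ∀ i → Algebra.Carrier (𝔅 i)
      ; _≈_           = λ x y → ∀ i → Algebra._≈_ (𝔅 i) (x i) (y i)
      ; isEquivalence = record
        { refl  = λ i → Algebra.refl (𝔅 i)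
        ; sym   = λ p i → Algebra.sym (𝔅 i) (p i)
        ; trans = λ p q i → Algebra.trans (𝔅 i) (p i) (q i)
        }
      }
    ; nonempty = λ i → Algebra.nonempty (𝔅 i)
    ; op       = λ f xs i → Algebra.op (𝔅 i) f (λ j → xs j i)
    ; op-cong  = λ f p i → Algebra.op-cong (𝔅 i) f (λ j → p j i)
    }

  -- Some finite tuple lies in no proper subuniverse.
  FinitelyGenerated : Algebra τ → Set (lsuc ℓ)
  FinitelyGenerated 𝔄 = Σ ℕ λ n → Σ (Vector Carrier n) λ g →
    (S : Subuniverse 𝔄) → (∀ i → Subuniverse.Member S (g i)) → ∀ a → Subuniverse.Member S a
    where open Algebra 𝔄

Class : ∀ {ℓ} → Signature ℓ → (c : Level) → Set (lsuc ℓ ⊔ lsuc c)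
Class τ c = Algebra τ → Set c

record IsPseudovariety {ℓ c} {τ : Signature ℓ} (𝒞 : Class τ c) : Set (lsuc ℓ ⊔ c) where
  field
    finitelyGenerated : ∀ {𝔄} → 𝒞 𝔄 → FinitelyGenerated 𝔄
    homomorphicImages : ∀ {𝔄 𝔅} → 𝒞 𝔄 → HomomorphicImage 𝔅 𝔄 → 𝒞 𝔅
    subproducts       : ∀ {n} (𝔅 : Fin n → Algebra τ) → (∀ i → 𝒞 (𝔅 i)) →
                        (S : Subuniverse (∏ 𝔅)) (ne : ∃ (Subuniverse.Member S)) →
                        FinitelyGenerated (subalgebra (∏ 𝔅) S ne) →
                        ∀ 𝔄 → Isomorphic 𝔄 (subalgebra (∏ 𝔅) S ne) → 𝒞 𝔄

------------------------------------------------------------------------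
-- Uniformities

-- Subsets of X × X, i.e. relations compatible with the equality of X.
record Subset² {a ℓ} (X : Setoid a ℓ) (r : Level) : Set (a ⊔ ℓ ⊔ lsuc r) where
  open Setoid X
  field
    rel  : Rel Carrier r
    resp : rel Respects₂ _≈_

open Subset²

module _ {a ℓ r : Level} {X : Setoid a ℓ} where

  infixl 6 _⊓_

  _⊓_ : Subset² X r → Subset² X r → Subset² X r
  U ⊓ V = record
    { rel  = rel U ∩ rel V
    ; resp = (λ p (u , v) → proj₁ (resp U) p u , proj₁ (resp V) p v)
           , (λ p (u , v) → proj₂ (resp U) p u , proj₂ (resp V) p v)
    }

  _⁻¹ : Subset² X r → Subset² X r
  U ⁻¹ = record { rel = flip (rel U) ; resp = proj₂ (resp U) , proj₁ (resp U) }

preimage : ∀ {a ℓ b m r} {X : Setoid a ℓ} {Y : Setoid b m} → Func X Y → Subset² Y r → Subset² X r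
preimage f V = record
  { rel  = λ x y → rel V (to x) (to y)
  ; resp = (λ p → proj₁ (resp V) (Func.cong f p)) , (λ p → proj₂ (resp V) (Func.cong f p))
  }
  where open Func f using (to)

record Uniformity {a ℓ} (X : Setoid a ℓ) (r e : Level) : Set (a ⊔ ℓ ⊔ lsuc r ⊔ lsuc e) where
  field
    Entourage    : Subset² X r → Set e
    inhabited    : ∃ Entourage
    upward       : ∀ {U V} → rel U ⇒ rel V → Entourage U → Entourage V
    intersection : ∀ {U V} → Entourage U → Entourage V → Entourage (U ⊓ V)
    diagonal     : ∀ {U} → Entourage U → Reflexive (rel U)
    converse     : ∀ {U} → Entourage U → Entourage (U ⁻¹)
    halving      : ∀ {U} → Entourage U → ∃ λ V → Entourage V × Trans (rel V) (rel V) (rel U)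

UniformlyContinuous : ∀ {a ℓ b m r e d} {X : Setoid a ℓ} {Y : Setoid b m} →
                      Uniformity X r e → Uniformity Y r d → Func X Y → Set (b ⊔ m ⊔ lsuc r ⊔ e ⊔ d)
UniformlyContinuous 𝒰 𝒱 f =
  ∀ V → Uniformity.Entourage 𝒱 V → Uniformity.Entourage 𝒰 (preimage f V)

-- The filter generated by a family of subsets: the supersets of finite
-- intersections of members of the family.  It is a uniformity because the
-- members are equivalence relations.
generatedBy : ∀ {a ℓ i p} r {X : Setoid a ℓ} {I : Set i} (E : I → Subset² X p) →
              (∀ j → IsEquivalence (rel (E j))) → Uniformity X (p ⊔ r) (i ⊔ a ⊔ p ⊔ r)
generatedBy {p = p} r {X} {I} E equiv = record
  { Entourage    = λ U → ∃ λ n → Σ (Vector I n) λ js → meet js ⇒ rel U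
  ; inhabited    = meetSet [] , 0 , [] , lift
  ; upward       = λ U⊆V (n , js , h) → n , js , λ q → U⊆V (h q)
  ; intersection = λ (m , js , h) (n , ks , h′) → m + n , (js ++ ks) ,
                     λ q → h (left js ks q) , h′ (right js ks q)
  ; diagonal     = λ (n , js , h) → h (λ i → IsEquivalence.refl (equiv (js i)))
  ; converse     = λ (n , js , h) → n , js , λ q → h (λ i → IsEquivalence.sym (equiv (js i)) (q i))
  ; halving      = λ (n , js , h) → meetSet js , (n , js , lift) ,
                     λ q q′ → h (λ i → IsEquivalence.trans (equiv (js i)) (lower q i) (lower q′ i))
  }
  where
  open Setoid X using (Carrier)

  meet : ∀ {n} → Vector I n → Rel Carrier p
  meet js x y = ∀ i → rel (E (js i)) x y

  meetSet : ∀ {n} → Vector I n → Subset² X (p ⊔ r)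
  meetSet js = record
    { rel  = λ x y → Lift r (meet js x y)
    ; resp = (λ e q → lift λ i → proj₁ (resp (E (js i))) e (lower q i))
           , (λ e q → lift λ i → proj₂ (resp (E (js i))) e (lower q i))
    }

  left : ∀ {m n} (js : Vector I m) (ks : Vector I n) → meet (js ++ ks) ⇒ meet js
  left js ks {x} {y} q i = subst (λ j → rel (E j) x y) (lookup-++ˡ js ks i) (q (i ↑ˡ _))

  right : ∀ {m n} (js : Vector I m) (ks : Vector I n) → meet (js ++ ks) ⇒ meet ks
  right js ks {x} {y} q i = subst (λ j → rel (E j) x y) (lookup-++ʳ js ks i) (q (_ ↑ʳ i))

------------------------------------------------------------------------
-- Term clones

T : ∀ {ℓ} → Signature ℓ → ℕ → Set ℓ
T τ k = Term τ (Fin k)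

module _ {ℓ : Level} {τ : Signature ℓ} where

  infix 4 _⊨_≐_

  _⊨_≐_ : Algebra τ → Rel (Term τ ℕ) ℓ
  𝔄 ⊨ s ≐ t = ∀ ρ → eval 𝔄 ρ s ≈ eval 𝔄 ρ t
    where open Algebra 𝔄 using (_≈_)

  -- Σ(𝒞), as a relation on terms over countably many variables.
  Identities : ∀ {c} → Class τ c → Rel (Term τ ℕ) (lsuc ℓ ⊔ c)
  Identities 𝒞 s t = ∀ 𝔄 → 𝒞 𝔄 → 𝔄 ⊨ s ≐ t

  -- The k-ary elements of the clone of the free algebra: k-ary terms modulo Σ(𝒞).
  F : ∀ {c} → Class τ c → ℕ → Setoid ℓ (lsuc ℓ ⊔ c)
  F 𝒞 k = record
    { Carrier       = T τ k
    ; _≈_           = λ s t → Identities 𝒞 (rename toℕ s) (rename toℕ t)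
    ; isEquivalence = record
      { refl  = λ 𝔄 _ _ → Algebra.refl 𝔄
      ; sym   = λ p 𝔄 𝔄∈𝒞 ρ → Algebra.sym 𝔄 (p 𝔄 𝔄∈𝒞 ρ)
      ; trans = λ p q 𝔄 𝔄∈𝒞 ρ → Algebra.trans 𝔄 (p 𝔄 𝔄∈𝒞 ρ) (q 𝔄 𝔄∈𝒞 ρ)
      }
    }

  termOp : (𝔄 : Algebra τ) {k : ℕ} → T τ k → Vector (Algebra.Carrier 𝔄) k → Algebra.Carrier 𝔄
  termOp 𝔄 t ā = eval 𝔄 ā t

  -- The k-ary operations induced by some term; the term witnesses membership
  -- and plays no role in equality.
  Clo : Algebra τ → ℕ → Setoid ℓ ℓ
  Clo 𝔄 k = record
    { Carrier       = Σ (Vector Carrier k → Carrier) λ f →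
                      Σ (T τ k) λ t → ∀ ā → f ā ≈ termOp 𝔄 t ā
    ; _≈_           = λ f g → ∀ ā → proj₁ f ā ≈ proj₁ g ā
    ; isEquivalence = record
      { refl  = λ _ → refl
      ; sym   = λ p ā → sym (p ā)
      ; trans = λ p q ā → trans (p ā) (q ā)
      }
    }
    where open Algebra 𝔄

  -- Generated by the sets {(f , g) | f ā ≈ g ā}.
  pointwiseConvergence : (𝔄 : Algebra τ) (r : Level) (k : ℕ) → Uniformity (Clo 𝔄 k) (ℓ ⊔ r) (ℓ ⊔ r)
  pointwiseConvergence 𝔄 r k = generatedBy r
    (λ (ā : Vector Carrier k) → record
      { rel  = λ f g → proj₁ f ā ≈ proj₁ g ā
      ; resp = (λ p q → trans q (p ā)) , (λ p q → trans (sym (p ā)) q)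
      })
    (λ ā → record { refl = refl ; sym = sym ; trans = trans })
    where open Algebra 𝔄

  -- Entourages are subsets at the level lsuc ℓ ⊔ c, where equality on F 𝒞 k lives.
  UniformityOnFreeClone : ∀ {c} → Class τ c → Set (lsuc (lsuc ℓ ⊔ c))
  UniformityOnFreeClone {c} 𝒞 =
    (k : ℕ) .{{_ : NonZero k}} → Uniformity (F 𝒞 k) (lsuc ℓ ⊔ c) (lsuc ℓ ⊔ c)

  naturalMap : (𝔄 : Algebra τ) {k : ℕ} → T τ k → Setoid.Carrier (Clo 𝔄 k)
  naturalMap 𝔄 t = termOp 𝔄 t , t , λ _ → Algebra.refl 𝔄

  NaturalWellDefined : ∀ {c} → Class τ c → Algebra τ → Set (lsuc ℓ ⊔ c)
  NaturalWellDefined 𝒞 𝔄 = (k : ℕ) .{{_ : NonZero k}} → ∀ s t →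
    Setoid._≈_ (F 𝒞 k) s t → Setoid._≈_ (Clo 𝔄 k) (naturalMap 𝔄 s) (naturalMap 𝔄 t)

  natural : ∀ {c} (𝒞 : Class τ c) (𝔄 : Algebra τ) → NaturalWellDefined 𝒞 𝔄 →
            (k : ℕ) .{{_ : NonZero k}} → Func (F 𝒞 k) (Clo 𝔄 k)
  natural 𝒞 𝔄 wd k = record { to = naturalMap 𝔄 ; cong = λ {s} {t} → wd k s t }

  NaturalUniformlyContinuous : ∀ {c} (𝒞 : Class τ c) → UniformityOnFreeClone 𝒞 →
                               (𝔄 : Algebra τ) → NaturalWellDefined 𝒞 𝔄 → Set (lsuc (lsuc ℓ ⊔ c))
  NaturalUniformlyContinuous {c} 𝒞 𝒰 𝔄 wd = (k : ℕ) .{{_ : NonZero k}} →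
    UniformlyContinuous (𝒰 k) (pointwiseConvergence 𝔄 (lsuc ℓ ⊔ c) k) (natural 𝒞 𝔄 wd k)

{-# OPTIONS --safe #-}
module Submission where

-- The uniformity on the k-ary part of the free clone is generated by the
-- equivalence relations "s and t take the same value in 𝔅 at b̄", one for each
-- member 𝔅 of 𝒞 and each k-tuple b̄ in 𝔅; that is, it is the coarsest uniformity
-- making all natural maps to the clones of members of 𝒞 uniformly continuous.
-- With this choice (i) implies (ii) directly.
--
-- For the converse, let g be a nonempty tuple generating 𝔄.  The set of pairs of
-- terms that agree in 𝔄 at g is the preimage of a basic entourage, so it contains
-- all pairs agreeing at finitely many tuples b̄₁, …, b̄ₘ in members 𝔅₁, …, 𝔅ₘ
-- of 𝒞.  Inside the product of the 𝔅ᵢ, let 𝔖 be the subalgebra generated by the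
-- tuple b whose image under the i-th projection is b̄ᵢ.  Then t(b) ↦ t(g) is a well-defined
-- homomorphism from 𝔖 onto 𝔄 (evaluationHom, evaluationHom-surjective).  Since 𝔖
-- is a finitely generated subalgebra of a finite product of members of 𝒞, it lies
-- in 𝒞, and hence so does its homomorphic image 𝔄.

open import Level using (Level; _⊔_; Lift; lift; lower) renaming (suc to lsuc)
open import Data.Fin using (Fin; zero; suc; toℕ)
open import Data.Nat using (ℕ; zero; suc)
open import Data.Product using (Σ; ∃; _×_; _,_; proj₁; proj₂)
open import Data.Vec.Functional using (Vector; head; tail; _∷_)
open import Function using (id; _∘_)
open import Function.Bundles using (_⇔_; mk⇔)
open import Function.Definitions using (Surjective)
open import Relation.Binary.PropositionalEquality using (_≡_; refl)
open import Defs

module _ {ℓ : Level} {τ : Signature ℓ} where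

  module _ (𝔄 : Algebra τ) where
    open Algebra 𝔄 hiding (refl)

    eval-rename : ∀ {V W : Set} {ρ : W → Carrier} {σ : V → Carrier} (f : V → W) →
                  (∀ x → ρ (f x) ≡ σ x) → ∀ t → eval 𝔄 ρ (rename f t) ≈ eval 𝔄 σ t
    eval-rename f p (var x)    = reflexive (p x)
    eval-rename f p (app o ts) = op-cong o (λ i → eval-rename f p (ts i))

    -- A finite tuple as an assignment to countably many variables; the variables
    -- beyond the tuple are sent to an arbitrary element.
    extend : ∀ {k} → Vector Carrier k → ℕ → Carrier
    extend {zero}  ā _       = nonempty
    extend {suc k} ā zero    = head ā
    extend {suc k} ā (suc n) = extend (tail ā) n

    extend-toℕ : ∀ {k} (ā : Vector Carrier k) i → extend ā (toℕ i) ≡ ā i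
    extend-toℕ ā zero    = refl
    extend-toℕ ā (suc i) = extend-toℕ (tail ā) i

    -- An identity between k-ary terms, which quantifies over assignments to
    -- countably many variables, gives an equality of k-ary term operations.
    ⊨⇒termOp-≈ : ∀ {k} (s t : T τ k) → 𝔄 ⊨ rename toℕ s ≐ rename toℕ t →
                 ∀ ā → termOp 𝔄 s ā ≈ termOp 𝔄 t ā
    ⊨⇒termOp-≈ s t s≐t ā =
      trans (sym (eval-rename toℕ (extend-toℕ ā) s))
            (trans (s≐t (extend ā)) (eval-rename toℕ (extend-toℕ ā) t))

  module _ (𝔄 : Algebra τ) {k : ℕ} (g : Vector (Algebra.Carrier 𝔄) k) where
    open Algebra 𝔄 renaming (refl to ≈-refl)

    -- The subuniverse generated by g, as the set of values of k-ary terms at g.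
    generated : Subuniverse 𝔄
    generated = record
      { Member    = λ a → Σ (T τ k) λ t → a ≈ eval 𝔄 g t
      ; respects  = λ p (t , q) → t , trans (sym p) q
      ; op-closed = λ f xs ms → app f (proj₁ ∘ ms) , op-cong f (proj₂ ∘ ms)
      }

    module _ (inhabited : ∃ (Subuniverse.Member generated)) where

      generated-finitelyGenerated : FinitelyGenerated (subalgebra 𝔄 generated inhabited)
      generated-finitelyGenerated = k , (λ i → g i , var i , ≈-refl) , λ S g∈S (a , t , a≈t) →
        Subuniverse.respects S (sym a≈t) (value∈ S g∈S t)
        where
        value∈ : (S : Subuniverse (subalgebra 𝔄 generated inhabited)) →
                 (∀ i → Subuniverse.Member S (g i , var i , ≈-refl)) →
                 ∀ t → Subuniverse.Member S (eval 𝔄 g t , t , ≈-refl)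
        value∈ S g∈S (var i)    = g∈S i
        -- op-closed yields the same element with another membership witness;
        -- respects exchanges the witnesses.
        value∈ S g∈S (app f ts) = Subuniverse.respects S ≈-refl
          (Subuniverse.op-closed S f (λ i → _ , ts i , ≈-refl) (λ i → value∈ S g∈S (ts i)))

      -- The map t(g) ↦ t(h), given that it is well-defined.
      evaluationHom : (𝔅 : Algebra τ) (h : Vector (Algebra.Carrier 𝔅) k) →
        (∀ s t → eval 𝔄 g s ≈ eval 𝔄 g t → Algebra._≈_ 𝔅 (eval 𝔅 h s) (eval 𝔅 h t)) →
        Homomorphism (subalgebra 𝔄 generated inhabited) 𝔅
      evaluationHom 𝔅 h wd = record
        { func = record
          { to   = λ (_ , t , _) → eval 𝔅 h t
          ; cong = λ { {_ , s , x≈s} {_ , t , y≈t} x≈y →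
                       wd s t (trans (sym x≈s) (trans x≈y y≈t)) }
          }
        ; homo = λ _ _ → Algebra.refl 𝔅
        }

      evaluationHom-surjective : ∀ 𝔅 h wd →
        (∀ b → Σ (T τ k) λ t → Algebra._≈_ 𝔅 b (eval 𝔅 h t)) →
        Surjective (Algebra._≈_ (subalgebra 𝔄 generated inhabited)) (Algebra._≈_ 𝔅)
                   (Homomorphism.to (evaluationHom 𝔅 h wd))
      evaluationHom-surjective 𝔅 h wd gen b =
        let t , b≈t = gen b in
        (eval 𝔄 g t , t , ≈-refl) ,
        λ {x} x≈t → Algebra.trans 𝔅
          (Homomorphism.to-cong (evaluationHom 𝔅 h wd) {x} {_ , t , ≈-refl} x≈t)
          (Algebra.sym 𝔅 b≈t)

  eval-∏ : ∀ {m} (𝔅 : Fin m → Algebra τ) {V : Set} (ρ : V → Algebra.Carrier (∏ 𝔅)) t i →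
           Algebra._≈_ (𝔅 i) (eval (∏ 𝔅) ρ t i) (eval (𝔅 i) (λ x → ρ x i) t)
  eval-∏ 𝔅 ρ (var x)    i = Algebra.refl (𝔅 i)
  eval-∏ 𝔅 ρ (app f ts) i = Algebra.op-cong (𝔅 i) f (λ j → eval-∏ 𝔅 ρ (ts j) i)

  Isomorphic-refl : (𝔄 : Algebra τ) → Isomorphic 𝔄 𝔄
  Isomorphic-refl 𝔄 =
    record { func = record { to = id ; cong = id } ; homo = λ _ _ → Algebra.refl 𝔄 } ,
    id , λ y → y , id

module _ {ℓ c : Level} {τ : Signature ℓ} (𝒞 : Class τ c) where

  -- A k-tuple in a member of 𝒞.
  Point : ℕ → Set (lsuc ℓ ⊔ c)
  Point k = Σ (Algebra τ) λ 𝔅 → 𝒞 𝔅 × Vector (Algebra.Carrier 𝔅) k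

  -- Two terms are related when they take the same value at the given point.
  AgreeAt : ∀ {k} → Point k → Subset² (F 𝒞 k) ℓ
  AgreeAt (𝔅 , 𝔅∈𝒞 , b̄) = record
    { rel  = λ s t → termOp 𝔅 s b̄ ≈ termOp 𝔅 t b̄
    ; resp = (λ {_} {t} {t′} p q → trans q (⊨⇒termOp-≈ 𝔅 t t′ (p 𝔅 𝔅∈𝒞) b̄))
           , (λ {_} {s} {s′} p q → trans (sym (⊨⇒termOp-≈ 𝔅 s s′ (p 𝔅 𝔅∈𝒞) b̄)) q)
    }
    where open Algebra 𝔅

  -- An entourage is a relation containing every pair of terms that agree at some
  -- finite set of points, which may lie in different members of 𝒞.
  freeCloneUniformity : UniformityOnFreeClone 𝒞
  freeCloneUniformity k = generatedBy (lsuc ℓ ⊔ c) AgreeAt λ (𝔅 , _) →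
    record { refl = Algebra.refl 𝔅 ; sym = Algebra.sym 𝔅 ; trans = Algebra.trans 𝔅 }

  member⇒wellDefined : ∀ {𝔄} → 𝒞 𝔄 → NaturalWellDefined 𝒞 𝔄
  member⇒wellDefined {𝔄} 𝔄∈𝒞 k s t s≈t = ⊨⇒termOp-≈ 𝔄 s t (s≈t 𝔄 𝔄∈𝒞)

  member⇒uniformlyContinuous : ∀ {𝔄} → 𝒞 𝔄 → (wd : NaturalWellDefined 𝒞 𝔄) →
                               NaturalUniformlyContinuous 𝒞 freeCloneUniformity 𝔄 wd
  member⇒uniformlyContinuous {𝔄} 𝔄∈𝒞 wd k V (m , ās , meet⊆V) =
    m , (λ i → 𝔄 , 𝔄∈𝒞 , ās i) , λ agree → meet⊆V agree

  -- The hypothesis agree⇒ says that agreement at finitely many points of members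
  -- of 𝒞 forces agreement in 𝔄 at a generating tuple h.  The arity is positive so
  -- that the subalgebra generated inside the product is nonempty even without
  -- nullary operations.
  finitelyDetermined⇒member : IsPseudovariety 𝒞 → ∀ {𝔄 : Algebra τ} {k m} →
    (h : Vector (Algebra.Carrier 𝔄) (suc k)) →
    (∀ a → Subuniverse.Member (generated 𝔄 h) a) →
    (ps : Vector (Point (suc k)) m) →
    (∀ s t → (∀ i → Subset².rel (AgreeAt (ps i)) s t) →
             Algebra._≈_ 𝔄 (eval 𝔄 h s) (eval 𝔄 h t)) →
    𝒞 𝔄
  finitelyDetermined⇒member pv {𝔄} {k} {m} h gen ps agree⇒ =
    homomorphicImages
      (subproducts 𝔅 (λ i → proj₁ (proj₂ (ps i))) (generated (∏ 𝔅) b) inhabited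
        (generated-finitelyGenerated (∏ 𝔅) b inhabited) _ (Isomorphic-refl _))
      (evaluationHom (∏ 𝔅) b inhabited 𝔄 h wd ,
       evaluationHom-surjective (∏ 𝔅) b inhabited 𝔄 h wd gen)
    where
    open IsPseudovariety pv

    𝔅 : Fin m → Algebra τ
    𝔅 i = proj₁ (ps i)

    b : Vector (Algebra.Carrier (∏ 𝔅)) (suc k)
    b j i = proj₂ (proj₂ (ps i)) j

    inhabited : ∃ (Subuniverse.Member (generated (∏ 𝔅) b))
    inhabited = b zero , var zero , Algebra.refl (∏ 𝔅)

    wd : ∀ s t → Algebra._≈_ (∏ 𝔅) (eval (∏ 𝔅) b s) (eval (∏ 𝔅) b t) →
         Algebra._≈_ 𝔄 (eval 𝔄 h s) (eval 𝔄 h t)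
    wd s t s≈t = agree⇒ s t λ i → let open Algebra (𝔅 i) in
      trans (sym (eval-∏ 𝔅 b s i)) (trans (s≈t i) (eval-∏ 𝔅 b t i))

  uniformlyContinuous⇒member : IsPseudovariety 𝒞 → ∀ {𝔄} → FinitelyGenerated 𝔄 →
    (wd : NaturalWellDefined 𝒞 𝔄) →
    NaturalUniformlyContinuous 𝒞 freeCloneUniformity 𝔄 wd → 𝒞 𝔄
  uniformlyContinuous⇒member pv {𝔄} (n , g , gen) wd uc =
    let m , ps , meet⊆ = uc (suc n) agreeAtH (1 , (λ _ → h) , λ agree → lift (agree zero))
    in finitelyDetermined⇒member pv h
         (gen (generated 𝔄 h) (λ i → var (suc i) , ≈-refl)) ps
         (λ s t agree → lower (meet⊆ {s} {t} agree))
    where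
    open Algebra 𝔄 using (Carrier; _≈_; sym; trans; nonempty) renaming (refl to ≈-refl)

    -- The generating tuple may be empty; adding an element makes the arity positive.
    h : Vector Carrier (suc n)
    h = nonempty ∷ g

    -- The basic entourage of pointwise convergence given by the tuple h.
    agreeAtH : Subset² (Clo 𝔄 (suc n)) (lsuc ℓ ⊔ c)
    agreeAtH = record
      { rel  = λ f f′ → Lift (lsuc ℓ ⊔ c) (proj₁ f h ≈ proj₁ f′ h)
      ; resp = (λ p q → lift (trans (lower q) (p h)))
             , (λ p q → lift (trans (sym (p h)) (lower q)))
      }

theorem1p1 : ∀ {ℓ c : Level} (τ : Signature ℓ) (𝒞 : Class τ c) → IsPseudovariety 𝒞 →
    Σ (UniformityOnFreeClone 𝒞) λ 𝒰 →
    (𝔄 : Algebra τ) → FinitelyGenerated 𝔄 →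
    𝒞 𝔄 ⇔ Σ (NaturalWellDefined 𝒞 𝔄) (λ wd → NaturalUniformlyContinuous 𝒞 𝒰 𝔄 wd)
theorem1p1 τ 𝒞 pv = freeCloneUniformity 𝒞 , λ 𝔄 fg → mk⇔
  (λ 𝔄∈𝒞 → member⇒wellDefined 𝒞 𝔄∈𝒞 ,
            member⇒uniformlyContinuous 𝒞 𝔄∈𝒞 (member⇒wellDefined 𝒞 𝔄∈𝒞))
  (λ (wd , uc) → uniformlyContinuous⇒member 𝒞 pv fg wd uc)
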